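{- Let $p$ be a prime and let $d \in \{0, 1, \dots, p - 1\}$. The congruence $A(d + p n) \equiv A(d) A(n) \pmod{p^2}$ holds for all $n \in \mathbb{Z}$ if and only if $d \in D(p)$, where \[ D(p) = \{d \in \{0, 1, \dots, p - 1\} : A(d) \equiv A(p - 1 - d) \pmod{p^2}\}. \]
   Context: $A(z)$ denotes the Ap\'ery function, the entire function \[ A(z) = \sum_{k \geq 0} \frac{\Gamma(z + k + 1)^2}{\Gamma(z - k + 1)^2\, \Gamma(k + 1)^4} = \sum_{k\ge 0}\frac{(-z)_k^2\,(z+1)_k^2}{k!^4}, \] where $(x)_k = x(x+1)\cdots(x+k-1)$; each summand is a polynomial in $z$. For non-negative integers $n$, $A(n)=\sum_{k\ge0}\binom{n}{k}^2\binom{n+k}{k}^2$ (the Ap\'ery numbers); for negative integers $n$, $A(n)$ is the value of this entire function (which satisfies $A(n)=A(-1-n)$, so it is an integer). -}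

module Defs where

open import Data.Nat as ℕ using (ℕ; zero; suc)
open import Data.Nat.Properties using (_!*_!≢0)
open import Data.Integer using (ℤ; +_; -_; _+_; _*_; ∣_∣)
open import Data.Integer.DivMod using (_/ℕ_)
open import Data.Nat.Combinatorics using ()
open import Data.Nat using (_!)

poch : ℤ → ℕ → ℤ
poch x zero    = + 1
poch x (suc k) = poch x k * (x + + k)

-- The k-th summand (-z)_k^2 (z+1)_k^2 / k!^4, computed as the square of
-- (-z)_k (z+1)_k / (k! k!); this quotient is exact (an integer).
term : ℤ → ℕ → ℤ
term z k = q * q
  where
  q : ℤ
  q = _/ℕ_ (poch (- z) k * poch (z + + 1) k) (k ! ℕ.* k !) {{k !* k !≢0}}

sumTo : ℕ → (ℕ → ℤ) → ℤ
sumTo zero    f = f zero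
sumTo (suc n) f = sumTo n f + f (suc n)

-- The Apéry function at an integer z.  For integer z all summands with
-- k > ∣z∣ vanish (for z ≥ 0, (-z)_k = 0 when k > z; for z = -m-1,
-- (z+1)_k = (-m)_k = 0 when k > m), so the series is the finite sum below.
A : ℤ → ℤ
A z = sumTo ∣ z ∣ (term z)

{-# OPTIONS --safe #-}

-- The summands of A are squares of integers root z k.  At z = pn those with p ∤ k are divisible
-- by p², while root (pa) (pb) ≡ root a b because (x - pa)(x + pa) ≡ x² modulo p²; so A(pn) ≡ A(n).
-- In Apéry's recurrence at z = d + pn the leading coefficient (d + 1 + pn)³ is invertible for
-- d + 1 < p, and at d = 0 the coefficient (pn)³ of A(pn - 1) vanishes modulo p².  Hence A(d + pn) is
-- A(pn) times a rational function of pn, and expanding to first order (Gessel)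
-- A(d + pn) ≡ A(n) (A(d) + pn e) with e independent of n.  The case n = -1, where
-- A(d - p) = A(p - 1 - d), shows that pe ≡ A(d) - A(p - 1 - d).

module Submission where

open import Defs
open import Data.Nat as ℕ using (ℕ; zero; suc; _!; _<_; _∸_)
import Data.Nat.Properties as ℕ
import Data.Nat.Divisibility as ℕ
open import Data.Nat.Primality using (Prime; euclidsLemma; ¬prime[0]; prime⇒nonTrivial)
open import Data.Integer using (ℤ; +_; -[1+_]; _+_; _-_; _*_; -_; ∣_∣; NonZero)
import Data.Integer.Properties as ℤ
open import Data.Integer.DivMod using (_/ℕ_; _%ℕ_; a≡a%ℕn+[a/ℕn]*n; n%ℕd<d)
open import Data.Integer.Divisibility using (_∣_)
open import Data.Integer.Divisibility.Signed renaming (_∣_ to _∣ₛ_)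
open import Data.Integer.Tactic.RingSolver using (solve-∀)
open import Data.Product using (∃-syntax; _×_; _,_)
open import Data.Sum using (_⊎_; inj₁; inj₂; [_,_]′)
open import Function.Base using (_∘_)
open import Function.Bundles using (_⇔_; mk⇔)
open import Relation.Binary.Bundles using (Setoid)
import Relation.Binary.Reasoning.Setoid as SetoidReasoning
open import Relation.Binary.PropositionalEquality
open import Relation.Nullary using (¬_; contradiction)

-- Rising factorials and exact division by factorials.

ℤ-induction : (P : ℤ → Set) → P (+ 0) → (∀ x → P x → P (x + + 1)) →
              (∀ x → P (x + + 1) → P x) → ∀ x → P x
ℤ-induction P P0 up down (+ zero) = P0
ℤ-induction P P0 up down (+ suc n) =
  subst P (ℤ.+-comm (+ n) (+ 1)) (up (+ n) (ℤ-induction P P0 up down (+ n)))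
ℤ-induction P P0 up down -[1+ zero ] = down -[1+ zero ] P0
ℤ-induction P P0 up down -[1+ suc n ] =
  down -[1+ suc n ] (ℤ-induction P P0 up down -[1+ n ])

-- The remainder is itself a multiple of `n` and smaller than `n`, hence zero.
/ℕ-exact : ∀ a n .{{_ : ℕ.NonZero n}} → + n ∣ₛ a → (a /ℕ n) * + n ≡ a
/ℕ-exact a n n∣a with a %ℕ n | a≡a%ℕn+[a/ℕn]*n a n | n%ℕd<d a n
... | zero  | eq | _   = sym (trans eq (ℤ.+-identityˡ _))
... | suc r | eq | r<n = contradiction
  (∣⇒∣ᵤ {+ n} (∣m+n∣n⇒∣m {m = + suc r} (subst (+ n ∣ₛ_) eq n∣a) (divides (a /ℕ n) refl)))
  (ℕ.>⇒∤ r<n)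

poch-sucˡ : ∀ x k → poch x (suc k) ≡ x * poch (x + + 1) k
poch-sucˡ x zero = lemma x
  where
  lemma : ∀ x → + 1 * (x + + 0) ≡ x * + 1
  lemma = solve-∀
poch-sucˡ x (suc k) = trans (cong (_* (x + + suc k)) (poch-sucˡ x k)) (lemma x (poch (x + + 1) k) (+ k))
  where
  lemma : ∀ x y k → x * y * (x + (+ 1 + k)) ≡ x * (y * (x + + 1 + k))
  lemma = solve-∀

poch-Δ : ∀ x k → poch (x + + 1) (suc k) ≡ poch x (suc k) + + suc k * poch (x + + 1) k
poch-Δ x k = trans (lemma x (poch (x + + 1) k) (+ k)) (cong (_+ + suc k * poch (x + + 1) k) (sym (poch-sucˡ x k)))
  where
  lemma : ∀ x y k → y * (x + + 1 + k) ≡ x * y + (+ 1 + k) * y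
  lemma = solve-∀

-- Outer induction on `k`, inner induction on `x` over all of ℤ. The value at 0 vanishes, and by
-- `poch-Δ` consecutive values differ by k + 1 times a rising factorial of length k, so divisibility
-- passes both up and down.
k!∣poch : ∀ k x → + (k !) ∣ₛ poch x k
k!∣poch zero    x = ∣-refl
k!∣poch (suc k) = ℤ-induction _ base
  (λ x h → subst (_ ∣ₛ_) (sym (poch-Δ x k)) (∣m∣n⇒∣m+n h (step x)))
  (λ x h → ∣m+n∣n⇒∣m (subst (_ ∣ₛ_) (poch-Δ x k) h) (step x))
  where
  base : + (suc k !) ∣ₛ poch (+ 0) (suc k)
  base = divides (+ 0) (poch-sucˡ (+ 0) k)
  step : ∀ x → + (suc k !) ∣ₛ + suc k * poch (x + + 1) k
  step x = subst (_∣ₛ + suc k * poch (x + + 1) k) (sym (ℤ.pos-* (suc k) (k !))) (*-monoʳ-∣ (+ suc k) (k!∣poch k (x + + 1)))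

-- The roots of the summands, reflection, and the range of summation.

numer : ℤ → ℕ → ℤ
numer z k = poch (- z) k * poch (z + + 1) k

-- The same quotient as the local `q` of `term`, so `term z k` is `root z k * root z k` by
-- computation. At z = n ≥ 0 it is the product of the binomials (n over k) and (n + k over k), up to
-- the sign (-1)^k.
root : ℤ → ℕ → ℤ
root z k = _/ℕ_ (numer z k) (k ! ℕ.* k !) {{k ℕ.!* k !≢0}}

k!²≢0 : ∀ k → NonZero (+ (k ! ℕ.* k !))
k!²≢0 k = k ℕ.!* k !≢0

root-numer : ∀ z k → root z k * + (k ! ℕ.* k !) ≡ numer z k
root-numer z k = /ℕ-exact (numer z k) (k ! ℕ.* k !) {{k ℕ.!* k !≢0}}
  (subst (_∣ₛ numer z k) (sym (ℤ.pos-* (k !) (k !)))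
    (∣-trans (*-monoˡ-∣ (+ (k !)) (k!∣poch k (- z))) (*-monoʳ-∣ (poch (- z) k) (k!∣poch k (z + + 1)))))

reflect : ℤ → ℤ
reflect z = - + 1 - z

-- The map z ↦ -1 - z exchanges -z and z + 1, hence the two rising factorials.
root-reflect : ∀ z k → root (reflect z) k ≡ root z k
root-reflect z k = cong (λ a → _/ℕ_ a (k ! ℕ.* k !) {{k ℕ.!* k !≢0}})
  (trans (cong₂ (λ x y → poch x k * poch y k) (lemma₁ z) (lemma₂ z)) (ℤ.*-comm (poch (z + + 1) k) _))
  where
  lemma₁ : ∀ z → - (- + 1 - z) ≡ z + + 1
  lemma₁ = solve-∀
  lemma₂ : ∀ z → - + 1 - z + + 1 ≡ - z
  lemma₂ = solve-∀

poch-vanish : ∀ {n k} → suc n ℕ.≤′ k → poch (- + n) k ≡ + 0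
poch-vanish {n} ℕ.≤′-refl =
  trans (cong (poch (- + n) n *_) (ℤ.+-inverseˡ (+ n))) (ℤ.*-zeroʳ (poch (- + n) n))
poch-vanish {n} {suc k} (ℕ.≤′-step n<k) = cong (_* (- + n + + k)) (poch-vanish n<k)

reflect-+ : ∀ n → reflect (+ n) ≡ -[1+ n ]
reflect-+ zero    = refl
reflect-+ (suc n) = refl

root-vanish : ∀ z {k} → ∣ z ∣ < k → root z k ≡ + 0
root-vanish (+ n) {k} n<k with ℤ.i*j≡0⇒i≡0∨j≡0 (root (+ n) k)
  (trans (root-numer (+ n) k) (cong (_* poch (+ n + + 1) k) (poch-vanish (ℕ.≤⇒≤′ n<k))))
... | inj₁ root≡0 = root≡0
... | inj₂ k!²≡0  = contradiction k!²≡0 (ℕ.≢-nonZero⁻¹ _ {{k ℕ.!* k !≢0}} ∘ ℤ.+-injective)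
root-vanish -[1+ n ] {k} n<k =
  trans (trans (cong (λ z → root z k) (sym (reflect-+ n))) (root-reflect (+ n) k)) (root-vanish (+ n) (ℕ.<-trans (ℕ.n<1+n n) n<k))

term-vanish : ∀ z {k} → ∣ z ∣ < k → term z k ≡ + 0
term-vanish z z<k = cong₂ _*_ (root-vanish z z<k) (root-vanish z z<k)

-- Pads the sum with vanishing terms, so that values of `A` at different arguments can be compared
-- over a common range.
A-extend : ∀ z {m} → ∣ z ∣ ℕ.≤′ m → A z ≡ sumTo m (term z)
A-extend z ℕ.≤′-refl = refl
A-extend z {suc m} (ℕ.≤′-step z≤m) = trans (A-extend z z≤m)
  (sym (trans (cong (λ x → sumTo m (term z) + x) (term-vanish z (ℕ.s≤s (ℕ.≤′⇒≤ z≤m)))) (ℤ.+-identityʳ _)))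

sumTo-cong : ∀ n {f g} → (∀ k → f k ≡ g k) → sumTo n f ≡ sumTo n g
sumTo-cong zero    f≗g = f≗g 0
sumTo-cong (suc n) f≗g = cong₂ _+_ (sumTo-cong n f≗g) (f≗g (suc n))

A-reflect : ∀ z → A (reflect z) ≡ A z
A-reflect z = begin
  A (reflect z)              ≡⟨ A-extend (reflect z) (ℕ.≤⇒≤′ (ℕ.m≤m+n _ ∣ z ∣)) ⟩
  sumTo m (term (reflect z)) ≡⟨ sumTo-cong m (λ k → cong₂ _*_ (root-reflect z k) (root-reflect z k)) ⟩
  sumTo m (term z)           ≡⟨ A-extend z (ℕ.≤⇒≤′ (ℕ.m≤n+m _ ∣ reflect z ∣)) ⟨
  A z                        ∎
  where
  open ≡-Reasoning
  m = ∣ reflect z ∣ ℕ.+ ∣ z ∣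

-- Apéry's recurrence at every integer.

-- Relating everything to root z k at the previous index makes the certificate a polynomial identity.
numer-suc : ∀ z k → numer z (suc k) ≡ (+ suc k - + 1 - z) * (+ suc k + z) * numer z k
numer-suc z k = lemma z (+ k) (poch (- z) k) (poch (z + + 1) k)
  where
  lemma : ∀ z k a b → a * (- z + k) * (b * (z + + 1 + k)) ≡ (+ 1 + k - + 1 - z) * (+ 1 + k + z) * (a * b)
  lemma = solve-∀

-- The first rising factorial at z + 1 is -(z + 1) times the one at z. The spare factor z + 1
-- completes the second one to (z + 1)_(k+2). In `numer-suc-down` the two factorials change places.
numer-suc-up : ∀ z k → numer (z + + 1) (suc k) ≡ - ((+ suc k + z) * (+ suc k + z + + 1)) * numer z k
numer-suc-up z k = begin
  poch (- (z + + 1)) (suc k) * b                        ≡⟨ cong (_* b) (poch-sucˡ (- (z + + 1)) k) ⟩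
  - (z + + 1) * poch (- (z + + 1) + + 1) k * b          ≡⟨ cong (λ x → - (z + + 1) * poch x k * b) (lemma₁ z) ⟩
  - (z + + 1) * a * b                                   ≡⟨ lemma₂ (z + + 1) a b ⟩
  - a * ((z + + 1) * b)                                 ≡⟨ cong (- a *_) (poch-sucˡ (z + + 1) (suc k)) ⟨
  - a * poch (z + + 1) (suc (suc k))                    ≡⟨ lemma₃ z (+ k) a (poch (z + + 1) k) ⟩
  _                                                     ∎
  where
  open ≡-Reasoning
  a = poch (- z) k
  b = poch (z + + 1 + + 1) (suc k)
  lemma₁ : ∀ z → - (z + + 1) + + 1 ≡ - z
  lemma₁ = solve-∀
  lemma₂ : ∀ z a b → - z * a * b ≡ - a * (z * b)
  lemma₂ = solve-∀
  lemma₃ : ∀ z k a b → - a * (b * (z + + 1 + k) * (z + + 1 + (+ 1 + k))) ≡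
           - ((+ 1 + k + z) * (+ 1 + k + z + + 1)) * (a * b)
  lemma₃ = solve-∀

numer-suc-down : ∀ z k → numer (z - + 1) (suc k) ≡ - ((+ suc k - + 1 - z) * (+ suc k - z)) * numer z k
numer-suc-down z k = begin
  numer (z - + 1) (suc k)                ≡⟨ cong₂ (λ x y → poch x (suc k) * poch y (suc k)) (lemma₁ z) (lemma₂ z) ⟩
  b * poch z (suc k)                     ≡⟨ cong (b *_) (poch-sucˡ z k) ⟩
  b * (z * a)                            ≡⟨ lemma₃ z a b ⟩
  - a * (- z * b)                        ≡⟨ cong (- a *_) (poch-sucˡ (- z) (suc k)) ⟨
  - a * poch (- z) (suc (suc k))         ≡⟨ lemma₄ z (+ k) a (poch (- z) k) ⟩
  _                                      ∎
  where
  open ≡-Reasoning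
  a = poch (z + + 1) k
  b = poch (- z + + 1) (suc k)
  lemma₁ : ∀ z → - (z - + 1) ≡ - z + + 1
  lemma₁ = solve-∀
  lemma₂ : ∀ z → z - + 1 + + 1 ≡ z
  lemma₂ = solve-∀
  lemma₃ : ∀ z a b → b * (z * a) ≡ - a * (- z * b)
  lemma₃ = solve-∀
  lemma₄ : ∀ z k a b → - a * (b * (- z + k) * (- z + (+ 1 + k))) ≡
           - ((+ 1 + k - + 1 - z) * (+ 1 + k - z)) * (b * a)
  lemma₄ = solve-∀

-- The denominators at k + 1 and k differ by the factor (k + 1)², which is kept on the left to avoid
-- division.
root-step : ∀ x z k c → numer x (suc k) ≡ c * numer z k →
            + suc k * + suc k * root x (suc k) ≡ c * root z k
root-step x z k c eq = ℤ.*-cancelʳ-≡ _ _ f {{k!²≢0 k}} (begin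
  + suc k * + suc k * root x (suc k) * f                ≡⟨ lemma (+ suc k) (root x (suc k)) f ⟩
  root x (suc k) * (+ suc k * + suc k * f)              ≡⟨ cong (root x (suc k) *_) f-suc ⟨
  root x (suc k) * + (suc k ! ℕ.* suc k !)              ≡⟨ root-numer x (suc k) ⟩
  numer x (suc k)                                       ≡⟨ eq ⟩
  c * numer z k                                         ≡⟨ cong (c *_) (root-numer z k) ⟨
  c * (root z k * f)                                    ≡⟨ ℤ.*-assoc c _ f ⟨
  c * root z k * f                                      ∎)
  where
  open ≡-Reasoning
  f = + (k ! ℕ.* k !)
  lemma : ∀ s r f → s * s * r * f ≡ r * (s * s * f)
  lemma = solve-∀
  interchange : ∀ s f → s * f * (s * f) ≡ s * s * (f * f)
  interchange = solve-∀
  f-suc : + (suc k ! ℕ.* suc k !) ≡ + suc k * + suc k * f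
  f-suc = begin
    + (suc k ! ℕ.* suc k !)                          ≡⟨ ℤ.pos-* (suc k !) (suc k !) ⟩
    + (suc k !) * + (suc k !)                        ≡⟨ cong₂ _*_ (ℤ.pos-* (suc k) (k !)) (ℤ.pos-* (suc k) (k !)) ⟩
    + suc k * + (k !) * (+ suc k * + (k !))          ≡⟨ interchange (+ suc k) (+ (k !)) ⟩
    + suc k * + suc k * (+ (k !) * + (k !))          ≡⟨ cong (+ suc k * + suc k *_) (ℤ.pos-* (k !) (k !)) ⟨
    + suc k * + suc k * f                            ∎

cube : ℤ → ℤ
cube z = z * z * z

-- Apéry's polynomial (2z + 1)(17z² + 17z + 5), expanded.
middle : ℤ → ℤ
middle z = + 34 * cube z + + 51 * (z * z) + + 27 * z + + 5

-- Zeilberger's certificate for the Apéry recurrence.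
certificate : ℤ → ℤ → ℤ
certificate z k = + 4 * (+ 2 * z + + 1) * (k * (+ 2 * k + + 1) - (+ 2 * z + + 1) * (+ 2 * z + + 1))

-- Here `k` is the new index and `t` the root at k - 1, while `x`, `y`, `w` are k² times the roots
-- at z, z + 1, z - 1. All definitions are unfolded so that the ring solver sees a polynomial
-- identity.
certificate-identity : ∀ z k t →
  let x = (k - + 1 - z) * (k + z) * t
      y = - ((k + z) * (k + z + + 1)) * t
      w = - ((k - + 1 - z) * (k - z)) * t
      v = + 2 * z + + 1
  in (z + + 1) * (z + + 1) * (z + + 1) * (y * y) + z * z * z * (w * w)
     + + 4 * v * ((k - + 1) * (+ 2 * (k - + 1) + + 1) - v * v) * (k * k * (k * k) * (t * t)) ≡
     (+ 34 * (z * z * z) + + 51 * (z * z) + + 27 * z + + 5) * (x * x)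
     + + 4 * v * (k * (+ 2 * k + + 1) - v * v) * (x * x)
certificate-identity = solve-∀

term-recurrence : ∀ z k →
  cube (z + + 1) * term (z + + 1) (suc k) + cube z * term (z - + 1) (suc k) + certificate z (+ k) * term z k ≡
  middle z * term z (suc k) + certificate z (+ suc k) * term z (suc k)
-- The factor (k + 1)⁴ turns each square of a root at k + 1 into the square of a left side of
-- `root-step`.
term-recurrence z k = ℤ.*-cancelˡ-≡ (s * s * (s * s)) _ _ (begin
  s * s * (s * s) * (cube (z + + 1) * (y * y) + cube z * (w * w) + c₀ * (t * t))
    ≡⟨ lemma₁ s (cube (z + + 1)) (cube z) c₀ y w t ⟩
  cube (z + + 1) * (s * s * y * (s * s * y)) + cube z * (s * s * w * (s * s * w)) + c₀ * (s * s * (s * s) * (t * t))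
    ≡⟨ cong₂ (λ a b → cube (z + + 1) * (a * a) + cube z * (b * b) + c₀ * (s * s * (s * s) * (t * t)))
         (root-step (z + + 1) z k (- ((s + z) * (s + z + + 1))) (numer-suc-up z k)) (root-step (z - + 1) z k (- ((s - + 1 - z) * (s - z))) (numer-suc-down z k)) ⟩
  -- `s - + 1` computes to `+ k`, so this is still `c₀`, now in the form that the identity expects.
  cube (z + + 1) * (y′ * y′) + cube z * (w′ * w′) + certificate z (s - + 1) * (s * s * (s * s) * (t * t))
    ≡⟨ certificate-identity z s t ⟩
  middle z * (x′ * x′) + certificate z s * (x′ * x′)
    ≡⟨ cong (λ a → middle z * (a * a) + certificate z s * (a * a)) (root-step z z k ((s - + 1 - z) * (s + z)) (numer-suc z k)) ⟨
  middle z * (s * s * x * (s * s * x)) + certificate z s * (s * s * x * (s * s * x))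
    ≡⟨ lemma₂ s (middle z) (certificate z s) x ⟩
  s * s * (s * s) * (middle z * (x * x) + certificate z s * (x * x)) ∎)
  where
  open ≡-Reasoning
  s = + suc k
  c₀ = certificate z (+ k)
  t = root z k
  x = root z (suc k)
  y = root (z + + 1) (suc k)
  w = root (z - + 1) (suc k)
  x′ = (s - + 1 - z) * (s + z) * t
  y′ = - ((s + z) * (s + z + + 1)) * t
  w′ = - ((s - + 1 - z) * (s - z)) * t
  lemma₁ : ∀ s a b c y w t → s * s * (s * s) * (a * (y * y) + b * (w * w) + c * (t * t)) ≡
    a * (s * s * y * (s * s * y)) + b * (s * s * w * (s * s * w)) + c * (s * s * (s * s) * (t * t))
  lemma₁ = solve-∀
  lemma₂ : ∀ s a b x → a * (s * s * x * (s * s * x)) + b * (s * s * x * (s * s * x)) ≡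
    s * s * (s * s) * (a * (x * x) + b * (x * x))
  lemma₂ = solve-∀

-- The certificate terms telescope, and only the one at the upper end survives.
sum-recurrence : ∀ z m →
  cube (z + + 1) * sumTo m (term (z + + 1)) + cube z * sumTo m (term (z - + 1)) ≡
  middle z * sumTo m (term z) + certificate z (+ m) * term z m
sum-recurrence z zero = lemma z
  where
  lemma : ∀ z → (z + + 1) * (z + + 1) * (z + + 1) * + 1 + z * z * z * + 1 ≡
    (+ 34 * (z * z * z) + + 51 * (z * z) + + 27 * z + + 5) * + 1
    + + 4 * (+ 2 * z + + 1) * (+ 0 * (+ 2 * + 0 + + 1) - (+ 2 * z + + 1) * (+ 2 * z + + 1)) * + 1
  lemma = solve-∀
sum-recurrence z (suc m) = telescope (cube (z + + 1)) (cube z) (middle z)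
  (certificate z (+ m)) (certificate z (+ suc m)) _ _ _ _ _ _ _ (sum-recurrence z m) (term-recurrence z m)
  where
  telescope : ∀ a b c e e′ Y W X y w x x₀ →
    a * Y + b * W ≡ c * X + e * x₀ → a * y + b * w + e * x₀ ≡ c * x + e′ * x →
    a * (Y + y) + b * (W + w) ≡ c * (X + x) + e′ * x
  telescope a b c e e′ Y W X y w x x₀ h₁ h₂ = begin
    a * (Y + y) + b * (W + w)                              ≡⟨ lemma₁ a b (e * x₀) Y W y w ⟩
    a * Y + b * W + (a * y + b * w + e * x₀) - e * x₀      ≡⟨ cong₂ (λ u v → u + v - e * x₀) h₁ h₂ ⟩
    c * X + e * x₀ + (c * x + e′ * x) - e * x₀             ≡⟨ lemma₂ c (e * x₀) (e′ * x) X x ⟩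
    c * (X + x) + e′ * x                                   ∎
    where
    open ≡-Reasoning
    lemma₁ : ∀ a b f Y W y w → a * (Y + y) + b * (W + w) ≡ a * Y + b * W + (a * y + b * w + f) - f
    lemma₁ = solve-∀
    lemma₂ : ∀ c f g X x → c * X + f + (c * x + g) - f ≡ c * (X + x) + g
    lemma₂ = solve-∀

A-recurrence : ∀ z → cube (z + + 1) * A (z + + 1) + cube z * A (z - + 1) ≡ middle z * A z
A-recurrence z = begin
  cube (z + + 1) * A (z + + 1) + cube z * A (z - + 1)
    ≡⟨ cong₂ (λ a b → cube (z + + 1) * a + cube z * b) (extend (z + + 1) up) (extend (z - + 1) down) ⟩
  cube (z + + 1) * sumTo m (term (z + + 1)) + cube z * sumTo m (term (z - + 1))
    ≡⟨ sum-recurrence z m ⟩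
  middle z * sumTo m (term z) + certificate z (+ m) * term z m
    ≡⟨ cong₂ (λ a b → middle z * a + certificate z (+ m) * b) (extend z same)
         (sym (term-vanish z (ℕ.≤-reflexive (ℕ.+-comm 1 ∣ z ∣)))) ⟨
  middle z * A z + certificate z (+ m) * + 0
    ≡⟨ lemma (middle z * A z) (certificate z (+ m)) ⟩
  middle z * A z ∎
  where
  open ≡-Reasoning
  -- Large enough to cover the ranges at z - 1, z and z + 1, and beyond ∣ z ∣, so that the boundary
  -- term is zero.
  m = ∣ z ∣ ℕ.+ 1
  extend : ∀ x → ∣ x ∣ ℕ.≤ m → A x ≡ sumTo m (term x)
  extend x x≤m = A-extend x (ℕ.≤⇒≤′ x≤m)
  up = ℤ.∣i+j∣≤∣i∣+∣j∣ z (+ 1)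
  down = ℤ.∣i-j∣≤∣i∣+∣j∣ z (+ 1)
  same = ℕ.m≤m+n ∣ z ∣ 1
  lemma : ∀ a c → a + c * + 0 ≡ a
  lemma = solve-∀

-- Congruences, and cancellation modulo p² of factors prime to p.

infix 4 _≈_[mod_]

-- The equation is solved for `x`, so that matching on `refl` eliminates it and leaves ring
-- identities in the quotients.
record _≈_[mod_] (x y m : ℤ) : Set where
  constructor mod
  field
    quot : ℤ
    eq   : x ≡ y + quot * m

≈-refl : ∀ {m x} → x ≈ x [mod m ]
≈-refl {m} {x} = mod (+ 0) (sym (ℤ.+-identityʳ x))

≈-reflexive : ∀ {m x y} → x ≡ y → x ≈ y [mod m ]
≈-reflexive refl = ≈-refl

≈-sym : ∀ {m x y} → x ≈ y [mod m ] → y ≈ x [mod m ]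
≈-sym {m} {x} {y} (mod q refl) = mod (- q) (lemma m y q)
  where
  lemma : ∀ m y q → y ≡ y + q * m + - q * m
  lemma = solve-∀

≈-trans : ∀ {m x y z} → x ≈ y [mod m ] → y ≈ z [mod m ] → x ≈ z [mod m ]
≈-trans {m} {z = z} (mod q refl) (mod r refl) = mod (r + q) (lemma m z q r)
  where
  lemma : ∀ m z q r → z + r * m + q * m ≡ z + (r + q) * m
  lemma = solve-∀

≈-setoid : ℤ → Setoid _ _
≈-setoid m = record
  { Carrier       = ℤ
  ; _≈_           = λ x y → x ≈ y [mod m ]
  ; isEquivalence = record { refl = ≈-refl ; sym = ≈-sym ; trans = ≈-trans }
  }

+-cong-≈ : ∀ {m x x′ y y′} → x ≈ x′ [mod m ] → y ≈ y′ [mod m ] → x + y ≈ x′ + y′ [mod m ]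
+-cong-≈ {m} {x′ = x} {y′ = y} (mod q refl) (mod r refl) = mod (q + r) (lemma m x y q r)
  where
  lemma : ∀ m x y q r → x + q * m + (y + r * m) ≡ x + y + (q + r) * m
  lemma = solve-∀

*-cong-≈ : ∀ {m x x′ y y′} → x ≈ x′ [mod m ] → y ≈ y′ [mod m ] → x * y ≈ x′ * y′ [mod m ]
*-cong-≈ {m} {x′ = x} {y′ = y} (mod q refl) (mod r refl) = mod (q * y + r * x + q * r * m) (lemma m x y q r)
  where
  lemma : ∀ m x y q r → (x + q * m) * (y + r * m) ≡ x * y + (q * y + r * x + q * r * m) * m
  lemma = solve-∀

*-congˡ-≈ : ∀ {m y y′} x → y ≈ y′ [mod m ] → x * y ≈ x * y′ [mod m ]
*-congˡ-≈ x = *-cong-≈ (≈-refl {x = x})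

*-congʳ-≈ : ∀ {m x x′} y → x ≈ x′ [mod m ] → x * y ≈ x′ * y [mod m ]
*-congʳ-≈ y x≈x′ = *-cong-≈ x≈x′ (≈-refl {x = y})

∣⇒≈ : ∀ {m x y} → m ∣ₛ x - y → x ≈ y [mod m ]
∣⇒≈ {m} {x} {y} (divides q eq) = mod q (trans (lemma x y) (cong (λ z → y + z) eq))
  where
  lemma : ∀ x y → x ≡ y + (x - y)
  lemma = solve-∀

≈⇒∣ : ∀ {m x y} → x ≈ y [mod m ] → m ∣ₛ x - y
≈⇒∣ {m} {y = y} (mod q refl) = divides q (lemma m y q)
  where
  lemma : ∀ m y q → y + q * m - y ≡ q * m
  lemma = solve-∀

euclid : ∀ {p} → Prime p → ∀ a b → + p ∣ₛ a * b → (+ p ∣ₛ a) ⊎ (+ p ∣ₛ b)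
euclid p-prime a b p∣ab =
  [ inj₁ ∘ ∣ᵤ⇒∣ , inj₂ ∘ ∣ᵤ⇒∣ ]′
  (euclidsLemma ∣ a ∣ ∣ b ∣ p-prime (subst (_ ℕ.∣_) (ℤ.abs-* a b) (∣⇒∣ᵤ p∣ab)))

prime∤1 : ∀ {p} → Prime p → ¬ + p ∣ₛ + 1
prime∤1 {p} p-prime p∣1 = ℕ.>⇒∤ (ℕ.nonTrivial⇒n>1 p {{prime⇒nonTrivial p-prime}}) (∣⇒∣ᵤ p∣1)

euclid-∤ : ∀ {p} → Prime p → ∀ {a b} → ¬ + p ∣ₛ a → ¬ + p ∣ₛ b → ¬ + p ∣ₛ a * b
euclid-∤ p-prime {a} {b} p∤a p∤b = [ p∤a , p∤b ]′ ∘ euclid p-prime a b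

euclid-cancel : ∀ {p} → Prime p → ∀ {a} b → ¬ + p ∣ₛ a → + p ∣ₛ a * b → + p ∣ₛ b
euclid-cancel p-prime {a} b p∤a p∣ab with euclid p-prime a b p∣ab
... | inj₁ p∣a = contradiction p∣a p∤a
... | inj₂ p∣b = p∣b

-- Euclid's lemma twice: first b = qp, then p divides aq and hence q.
euclid-cancel² : ∀ {p} → Prime p → ∀ {a} b → ¬ + p ∣ₛ a → + p * + p ∣ₛ a * b → + p * + p ∣ₛ b
euclid-cancel² {suc p-1} p-prime {a} b p∤a p²∣ab
  with euclid-cancel p-prime b p∤a (∣-trans (∣n⇒∣m*n (+ suc p-1) ∣-refl) p²∣ab)
... | divides q refl = *-monoˡ-∣ (+ suc p-1) (euclid-cancel p-prime q p∤a
  (*-cancelʳ-∣ (+ suc p-1) (subst (_ ∣ₛ_) (sym (ℤ.*-assoc a q (+ suc p-1))) p²∣ab)))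
euclid-cancel² {zero} p-prime = contradiction p-prime ¬prime[0]

≈-cancel : ∀ {p} → Prime p → ∀ {a x y} → ¬ + p ∣ₛ a →
           a * x ≈ a * y [mod + p * + p ] → x ≈ y [mod + p * + p ]
≈-cancel p-prime {a} {x} {y} p∤a ax≈ay =
  ∣⇒≈ (euclid-cancel² p-prime (x - y) p∤a (subst (_ ∣ₛ_) (lemma a x y) (≈⇒∣ ax≈ay)))
  where
  lemma : ∀ a x y → a * x - a * y ≡ a * (x - y)
  lemma = solve-∀

-- Indices not divisible by p.

sumTo-cong-≈ : ∀ {m} n {f g} → (∀ k → f k ≈ g k [mod m ]) → sumTo n f ≈ sumTo n g [mod m ]
sumTo-cong-≈ zero    f≈g = f≈g 0
sumTo-cong-≈ (suc n) f≈g = +-cong-≈ (sumTo-cong-≈ n f≈g) (f≈g (suc n))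

p∤suc+* : ∀ {p j} m → suc j < p → ¬ p ℕ.∣ suc j ℕ.+ m ℕ.* p
p∤suc+* {p} {j} m j<p p∣ = ℕ.>⇒∤ j<p (ℕ.∣m+n∣m⇒∣n (subst (p ℕ.∣_) (ℕ.+-comm (suc j) _) p∣) (ℕ.n∣m*n m))

-- The prime is `suc p` here, so `p` indices are skipped between consecutive multiples. The sums
-- include their upper ends, which are multiples.
sumTo-sieve : ∀ {m} p {f} → (∀ {k} → ¬ suc p ℕ.∣ k → f k ≈ + 0 [mod m ]) →
              ∀ n → sumTo (n ℕ.* suc p) f ≈ sumTo n (λ j → f (j ℕ.* suc p)) [mod m ]
sumTo-sieve p vanish zero = ≈-refl
sumTo-sieve {m} p {f} vanish (suc n) = +-cong-≈ (≈-trans (skip p (ℕ.n<1+n p)) (sumTo-sieve p vanish n)) ≈-refl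
  where
  skip : ∀ j → j < suc p → sumTo (j ℕ.+ n ℕ.* suc p) f ≈ sumTo (n ℕ.* suc p) f [mod m ]
  skip zero    _   = ≈-refl
  skip (suc j) j<p = subst (λ x → sumTo (suc j ℕ.+ n ℕ.* suc p) f ≈ x [mod m ]) (ℤ.+-identityʳ _)
    (+-cong-≈ (skip j (ℕ.<-trans (ℕ.n<1+n j) j<p)) (vanish (p∤suc+* n j<p)))

-- Once -z is split off, the first rising factorial has only k factors left and is divisible by k!,
-- the second by (k + 1)!. Of the denominator (k + 1)!² just one factor k + 1 remains uncancelled.
z∣[1+k]*root : ∀ z k → z ∣ₛ + suc k * root z (suc k)
z∣[1+k]*root z k with k!∣poch k (- z + + 1) | k!∣poch (suc k) (z + + 1)
... | divides r eq₁ | divides s eq₂ = divides (- (r * s)) (ℤ.*-cancelʳ-≡ _ _ (f * g) {{k!*[1+k]!≢0}} (begin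
  + suc k * root z (suc k) * (f * g)                          ≡⟨ lemma₁ (+ suc k) (root z (suc k)) f g ⟩
  root z (suc k) * (+ suc k * f * g)                          ≡⟨ cong (λ x → root z (suc k) * (x * g)) (ℤ.pos-* (suc k) (k !)) ⟨
  root z (suc k) * (g * g)                                    ≡⟨ cong (root z (suc k) *_) (ℤ.pos-* (suc k !) (suc k !)) ⟨
  root z (suc k) * + (suc k ! ℕ.* suc k !)                    ≡⟨ root-numer z (suc k) ⟩
  poch (- z) (suc k) * poch (z + + 1) (suc k)                 ≡⟨ cong₂ _*_ (poch-sucˡ (- z) k) eq₂ ⟩
  - z * poch (- z + + 1) k * (s * g)                          ≡⟨ cong (λ x → - z * x * (s * g)) eq₁ ⟩
  - z * (r * f) * (s * g)                                     ≡⟨ lemma₂ z r s f g ⟩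
  - (r * s) * z * (f * g)                                     ∎))
  where
  open ≡-Reasoning
  f = + (k !)
  g = + (suc k !)
  k!*[1+k]!≢0 : NonZero (f * g)
  k!*[1+k]!≢0 = ℤ.i*j≢0 f g {{k ℕ.!≢0}} {{suc k ℕ.!≢0}}
  lemma₁ : ∀ s t f g → s * t * (f * g) ≡ t * (s * f * g)
  lemma₁ = solve-∀
  lemma₂ : ∀ z r s f g → - z * (r * f) * (s * g) ≡ - (r * s) * z * (f * g)
  lemma₂ = solve-∀

p∣root : ∀ {p} → Prime p → ∀ n {k} → ¬ p ℕ.∣ k → + p ∣ₛ root (+ p * n) k
p∣root {p} p-prime n {zero}  p∤k = contradiction (p ℕ.∣0) p∤k
p∣root {p} p-prime n {suc k} p∤k = euclid-cancel p-prime {+ suc k} (root (+ p * n) (suc k)) (p∤k ∘ ∣⇒∣ᵤ)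
  (∣-trans (∣m⇒∣m*n n ∣-refl) (z∣[1+k]*root (+ p * n) k))

-- Splitting rising factorials into blocks, and A(pn) modulo p².

poch-+ : ∀ x k j → poch x (j ℕ.+ k) ≡ poch x k * poch (x + + k) j
poch-+ x k zero    = sym (ℤ.*-identityʳ (poch x k))
poch-+ x k (suc j) = begin
  poch x (j ℕ.+ k) * (x + (+ j + + k))                 ≡⟨ cong (_* (x + (+ j + + k))) (poch-+ x k j) ⟩
  poch x k * poch (x + + k) j * (x + (+ j + + k))      ≡⟨ lemma (poch x k) (poch (x + + k) j) x (+ j) (+ k) ⟩
  poch x k * (poch (x + + k) j * (x + + k + + j))      ∎
  where
  open ≡-Reasoning
  lemma : ∀ a b x j k → a * b * (x + (j + k)) ≡ a * (b * (x + k + j))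
  lemma = solve-∀

poch-1 : ∀ k → poch (+ 1) k ≡ + (k !)
poch-1 zero    = refl
poch-1 (suc k) = trans (cong (_* + suc k) (poch-1 k))
  (trans (ℤ.*-comm (+ (k !)) (+ suc k)) (sym (ℤ.pos-* (suc k) (k !))))

-- Factors pair up as (v - u)(v + u) = v² - u².
poch-±-≈ : ∀ {m u} → u * u ≈ + 0 [mod m ] → ∀ y k →
           poch (y - u) k * poch (y + u) k ≈ poch y k * poch y k [mod m ]
poch-±-≈ u²≈0 y zero = ≈-refl
poch-±-≈ {m} {u} u²≈0 y (suc k) = begin
  a * (y - u + + k) * (b * (y + u + + k))      ≡⟨ lemma₁ a b u y (+ k) ⟩
  a * b * ((y + + k) * (y + + k) + - + 1 * (u * u))  ≈⟨ *-cong-≈ (poch-±-≈ u²≈0 y k)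
                                                  (+-cong-≈ (≈-refl {x = (y + + k) * (y + + k)}) (*-congˡ-≈ (- + 1) u²≈0)) ⟩
  c * c * ((y + + k) * (y + + k) + + 0)        ≡⟨ lemma₂ c (y + + k) ⟩
  c * (y + + k) * (c * (y + + k))              ∎
  where
  open SetoidReasoning (≈-setoid m)
  a = poch (y - u) k
  b = poch (y + u) k
  c = poch y k
  lemma₁ : ∀ a b u y k → a * (y - u + k) * (b * (y + u + k)) ≡ a * b * ((y + k) * (y + k) + - + 1 * (u * u))
  lemma₁ = solve-∀
  lemma₂ : ∀ c v → c * c * (v * v + + 0) ≡ c * v * (c * v)
  lemma₂ = solve-∀

-- For x ≡ 0 or 1 modulo p, poch x (bp) splits into b multiples of p and b blocks of p - 1 factors each.
module _ (p-1 : ℕ) where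

  p : ℕ
  p = suc p-1

  -- The product of the integers strictly between px and p(x + 1).
  block : ℤ → ℤ
  block x = poch (+ p * x + + 1) p-1

  blocks : ℕ → ℤ
  blocks zero    = + 1
  blocks (suc b) = blocks b * block (+ b)

  -- What `numer (+ p * a) (b ℕ.* p)` retains once the multiples of p are removed, just as
  -- `blocks b` is the part of (bp)! prime to p.
  shifted-blocks : ℤ → ℕ → ℤ
  shifted-blocks a zero    = + 1
  shifted-blocks a (suc b) = shifted-blocks a b * (block (+ b - a) * block (+ b + a))

  p^ : ℕ → ℤ
  p^ zero    = + 1
  p^ (suc b) = p^ b * + p

  p^≢0 : ∀ b → NonZero (p^ b)
  p^≢0 zero    = _
  p^≢0 (suc b) = ℤ.i*j≢0 (p^ b) (+ p) {{p^≢0 b}}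

  -- The p new factors begin with the multiple pc. In `poch-block-last` they begin at pc + 1 and end
  -- with the multiple p(c + 1).
  poch-block-first : ∀ x b c → x + + (b ℕ.* p) ≡ + p * c →
                     poch x (suc b ℕ.* p) ≡ poch x (b ℕ.* p) * (+ p * c * block c)
  poch-block-first x b c eq = begin
    poch x (p ℕ.+ b ℕ.* p)                               ≡⟨ poch-+ x (b ℕ.* p) p ⟩
    poch x (b ℕ.* p) * poch (x + + (b ℕ.* p)) p          ≡⟨ cong (λ y → poch x (b ℕ.* p) * poch y p) eq ⟩
    poch x (b ℕ.* p) * poch (+ p * c) p                  ≡⟨ cong (poch x (b ℕ.* p) *_) (poch-sucˡ (+ p * c) p-1) ⟩
    poch x (b ℕ.* p) * (+ p * c * block c)               ∎
    where open ≡-Reasoning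

  poch-block-last : ∀ x b c → x + + (b ℕ.* p) ≡ + p * c + + 1 →
                    poch x (suc b ℕ.* p) ≡ poch x (b ℕ.* p) * (+ p * (c + + 1) * block c)
  poch-block-last x b c eq = begin
    poch x (p ℕ.+ b ℕ.* p)                               ≡⟨ poch-+ x (b ℕ.* p) p ⟩
    poch x (b ℕ.* p) * poch (x + + (b ℕ.* p)) p          ≡⟨ cong (λ y → poch x (b ℕ.* p) * poch y p) eq ⟩
    poch x (b ℕ.* p) * (block c * (+ p * c + + 1 + + p-1))
      ≡⟨ cong (poch x (b ℕ.* p) *_) (lemma (block c) c (+ p-1)) ⟩
    poch x (b ℕ.* p) * (+ p * (c + + 1) * block c)       ∎
    where
    open ≡-Reasoning
    lemma : ∀ w c q → w * ((+ 1 + q) * c + + 1 + q) ≡ (+ 1 + q) * (c + + 1) * w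
    lemma = solve-∀

  -- The removed multiples of p, each divided by p, are exactly the factors of `numer a b`.
  numer-blocks : ∀ a b → numer (+ p * a) (b ℕ.* p) ≡ p^ b * p^ b * numer a b * shifted-blocks a b
  numer-blocks a zero    = refl
  numer-blocks a (suc b) = begin
    poch (- (+ p * a)) (suc b ℕ.* p) * poch (+ p * a + + 1) (suc b ℕ.* p)
      ≡⟨ cong₂ _*_ (poch-block-first (- (+ p * a)) b (+ b - a) eq₁) (poch-block-last (+ p * a + + 1) b (+ b + a) eq₂) ⟩
    x * (+ p * (+ b - a) * v) * (y * (+ p * (+ b + a + + 1) * w))
      ≡⟨ lemma₁ x y v w (+ p) (+ b) a ⟩
    x * y * (+ p * + p * ((- a + + b) * (a + + 1 + + b)) * (v * w))
      ≡⟨ cong (_* (+ p * + p * ((- a + + b) * (a + + 1 + + b)) * (v * w))) (numer-blocks a b) ⟩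
    p^ b * p^ b * (poch (- a) b * poch (a + + 1) b) * shifted-blocks a b * (+ p * + p * ((- a + + b) * (a + + 1 + + b)) * (v * w))
      ≡⟨ lemma₂ (p^ b) (+ p) (poch (- a) b) (poch (a + + 1) b) (- a + + b) (a + + 1 + + b) (shifted-blocks a b) (v * w) ⟩
    p^ b * + p * (p^ b * + p) * (poch (- a) b * (- a + + b) * (poch (a + + 1) b * (a + + 1 + + b))) * (shifted-blocks a b * (v * w))
      ∎
    where
    open ≡-Reasoning
    x = poch (- (+ p * a)) (b ℕ.* p)
    y = poch (+ p * a + + 1) (b ℕ.* p)
    v = block (+ b - a)
    w = block (+ b + a)
    lemma₀ : ∀ p a b → - (p * a) + b * p ≡ p * (b - a)
    lemma₀ = solve-∀
    lemma₀′ : ∀ p a b → p * a + + 1 + b * p ≡ p * (b + a) + + 1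
    lemma₀′ = solve-∀
    eq₁ : - (+ p * a) + + (b ℕ.* p) ≡ + p * (+ b - a)
    eq₁ = trans (cong (λ z → - (+ p * a) + z) (ℤ.pos-* b p)) (lemma₀ (+ p) a (+ b))
    eq₂ : + p * a + + 1 + + (b ℕ.* p) ≡ + p * (+ b + a) + + 1
    eq₂ = trans (cong (λ z → + p * a + + 1 + z) (ℤ.pos-* b p)) (lemma₀′ (+ p) a (+ b))
    lemma₁ : ∀ x y v w p b a → x * (p * (b - a) * v) * (y * (p * (b + a + + 1) * w)) ≡
             x * y * (p * p * ((- a + b) * (a + + 1 + b)) * (v * w))
    lemma₁ = solve-∀
    lemma₂ : ∀ q p m n c d s t → q * q * (m * n) * s * (p * p * (c * d) * t) ≡
             q * p * (q * p) * (m * c * (n * d)) * (s * t)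
    lemma₂ = solve-∀

  !-blocks : ∀ b → + ((b ℕ.* p) !) ≡ p^ b * + (b !) * blocks b
  !-blocks zero    = refl
  !-blocks (suc b) = begin
    + ((suc b ℕ.* p) !)                                          ≡⟨ poch-1 (suc b ℕ.* p) ⟨
    poch (+ 1) (suc b ℕ.* p)                                     ≡⟨ poch-block-last (+ 1) b (+ b) eq ⟩
    poch (+ 1) (b ℕ.* p) * (+ p * (+ b + + 1) * block (+ b))
      ≡⟨ cong (_* (+ p * (+ b + + 1) * block (+ b))) (trans (poch-1 (b ℕ.* p)) (!-blocks b)) ⟩
    p^ b * + (b !) * blocks b * (+ p * (+ b + + 1) * block (+ b))
      ≡⟨ lemma₂ (p^ b) (+ (b !)) (blocks b) (+ p) (+ b) (block (+ b)) ⟩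
    p^ b * + p * (+ suc b * + (b !)) * (blocks b * block (+ b))
      ≡⟨ cong (λ z → p^ b * + p * z * (blocks b * block (+ b))) (ℤ.pos-* (suc b) (b !)) ⟨
    p^ b * + p * + (suc b !) * (blocks b * block (+ b))         ∎
    where
    open ≡-Reasoning
    lemma₁ : ∀ b p → + 1 + b * p ≡ p * b + + 1
    lemma₁ = solve-∀
    eq : + 1 + + (b ℕ.* p) ≡ + p * + b + + 1
    eq = trans (cong (λ z → + 1 + z) (ℤ.pos-* b p)) (lemma₁ (+ b) (+ p))
    lemma₂ : ∀ q f s p b w → q * f * s * (p * (b + + 1) * w) ≡ q * p * ((+ 1 + b) * f) * (s * w)
    lemma₂ = solve-∀

  -- Numerator and denominator contain the same power of p, which cancels, so the two roots differ
  -- only by factors prime to p.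
  root-blocks : ∀ a b → blocks b * blocks b * root (+ p * a) (b ℕ.* p) ≡ shifted-blocks a b * root a b
  root-blocks a b = ℤ.*-cancelʳ-≡ _ _ (q * q * (f * f)) {{nonZero}} (begin
    v * v * r * (q * q * (f * f))                   ≡⟨ lemma₁ v r q f ⟩
    r * (q * f * v * (q * f * v))                   ≡⟨ cong (λ x → r * (x * x)) (!-blocks b) ⟨
    r * (+ ((b ℕ.* p) !) * + ((b ℕ.* p) !))         ≡⟨ cong (r *_) (ℤ.pos-* ((b ℕ.* p) !) ((b ℕ.* p) !)) ⟨
    r * + ((b ℕ.* p) ! ℕ.* (b ℕ.* p) !)             ≡⟨ root-numer (+ p * a) (b ℕ.* p) ⟩
    numer (+ p * a) (b ℕ.* p)                       ≡⟨ numer-blocks a b ⟩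
    q * q * numer a b * u                           ≡⟨ cong (λ x → q * q * x * u) (root-numer a b) ⟨
    q * q * (root a b * + (b ! ℕ.* b !)) * u        ≡⟨ cong (λ x → q * q * (root a b * x) * u) (ℤ.pos-* (b !) (b !)) ⟩
    q * q * (root a b * (f * f)) * u                ≡⟨ lemma₂ q (root a b) f u ⟩
    u * root a b * (q * q * (f * f))                ∎)
    where
    open ≡-Reasoning
    f = + (b !)
    q = p^ b
    r = root (+ p * a) (b ℕ.* p)
    u = shifted-blocks a b
    v = blocks b
    nonZero : NonZero (q * q * (f * f))
    nonZero = ℤ.i*j≢0 (q * q) (f * f) {{ℤ.i*j≢0 q q {{p^≢0 b}} {{p^≢0 b}}}} {{ℤ.i*j≢0 f f {{b ℕ.!≢0}} {{b ℕ.!≢0}}}}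
    lemma₁ : ∀ v r q f → v * v * r * (q * q * (f * f)) ≡ r * (q * f * v * (q * f * v))
    lemma₁ = solve-∀
    lemma₂ : ∀ q r f u → q * q * (r * (f * f)) * u ≡ u * r * (q * q * (f * f))
    lemma₂ = solve-∀

  shifted-blocks-≈ : ∀ a b → shifted-blocks a b ≈ blocks b * blocks b [mod + p * + p ]
  shifted-blocks-≈ a zero    = ≈-refl
  shifted-blocks-≈ a (suc b) = begin
    shifted-blocks a b * (block (+ b - a) * block (+ b + a))
      ≡⟨ cong₂ (λ x y → shifted-blocks a b * (poch x p-1 * poch y p-1)) (lemma₁ (+ p) (+ b) a) (lemma₂ (+ p) (+ b) a) ⟩
    shifted-blocks a b * (poch (+ p * + b + + 1 - + p * a) p-1 * poch (+ p * + b + + 1 + + p * a) p-1)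
      ≈⟨ *-cong-≈ (shifted-blocks-≈ a b) (poch-±-≈ (mod (a * a) (lemma₃ (+ p) a)) (+ p * + b + + 1) p-1) ⟩
    blocks b * blocks b * (block (+ b) * block (+ b))
      ≡⟨ lemma₄ (blocks b) (block (+ b)) ⟩
    blocks b * block (+ b) * (blocks b * block (+ b)) ∎
    where
    open SetoidReasoning (≈-setoid (+ p * + p))
    lemma₁ : ∀ p b a → p * (b - a) + + 1 ≡ p * b + + 1 - p * a
    lemma₁ = solve-∀
    lemma₂ : ∀ p b a → p * (b + a) + + 1 ≡ p * b + + 1 + p * a
    lemma₂ = solve-∀
    lemma₃ : ∀ p a → p * a * (p * a) ≡ + 0 + a * a * (p * p)
    lemma₃ = solve-∀
    lemma₄ : ∀ s w → s * s * (w * w) ≡ s * w * (s * w)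
    lemma₄ = solve-∀

  module _ (p-prime : Prime p) where

    p∤block : ∀ x → ¬ + p ∣ₛ block x
    p∤block x = go p-1 ℕ.≤-refl
      where
      lemma : ∀ p x j → p * x + + 1 + j ≡ + 1 + j + x * p
      lemma = solve-∀
      go : ∀ j → j ℕ.≤ p-1 → ¬ + p ∣ₛ poch (+ p * x + + 1) j
      go zero    _     = prime∤1 p-prime
      go (suc j) j<p-1 = euclid-∤ p-prime (go j (ℕ.<⇒≤ j<p-1)) λ p∣ →
        ℕ.>⇒∤ (ℕ.s≤s j<p-1) (∣⇒∣ᵤ {+ p} (∣m+n∣n⇒∣m {m = + suc j}
          (subst (+ p ∣ₛ_) (lemma (+ p) x (+ j)) p∣) (divides x refl)))

    p∤blocks : ∀ b → ¬ + p ∣ₛ blocks b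
    p∤blocks zero    = prime∤1 p-prime
    p∤blocks (suc b) = euclid-∤ p-prime (p∤blocks b) (p∤block (+ b))

    root-≈ : ∀ a b → root (+ p * a) (b ℕ.* p) ≈ root a b [mod + p * + p ]
    root-≈ a b = ≈-cancel p-prime (euclid-∤ p-prime (p∤blocks b) (p∤blocks b)) (begin
      blocks b * blocks b * root (+ p * a) (b ℕ.* p)     ≡⟨ root-blocks a b ⟩
      shifted-blocks a b * root a b                      ≈⟨ *-congʳ-≈ (root a b) (shifted-blocks-≈ a b) ⟩
      blocks b * blocks b * root a b                     ∎)
      where open SetoidReasoning (≈-setoid (+ p * + p))

    A-≈-suc : ∀ n → A (+ p * n) ≈ A n [mod + p * + p ]
    A-≈-suc n = begin
      A (+ p * n)
        -- The cut-off ∣ pn ∣ equals ∣ n ∣ p, so the sieve leaves precisely the range of `A n`.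
        ≡⟨ cong (λ m → sumTo m (term (+ p * n))) (trans (ℤ.abs-* (+ p) n) (ℕ.*-comm p ∣ n ∣)) ⟩
      sumTo (∣ n ∣ ℕ.* p) (term (+ p * n))
        ≈⟨ sumTo-sieve p-1 vanish ∣ n ∣ ⟩
      sumTo ∣ n ∣ (λ j → term (+ p * n) (j ℕ.* p))
        ≈⟨ sumTo-cong-≈ ∣ n ∣ (λ j → *-cong-≈ (root-≈ n j) (root-≈ n j)) ⟩
      A n ∎
      where
      open SetoidReasoning (≈-setoid (+ p * + p))
      lemma : ∀ q p → q * p * (q * p) ≡ + 0 + q * q * (p * p)
      lemma = solve-∀
      vanish : ∀ {k} → ¬ p ℕ.∣ k → term (+ p * n) k ≈ + 0 [mod + p * + p ]
      vanish p∤k with p∣root p-prime n p∤k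
      ... | divides q eq = mod (q * q) (trans (cong₂ _*_ eq eq) (lemma q (+ p)))

-- First-order expansions in pn modulo p².

-- The weight `g` carries the dependence on n that is not affine; it will be A(pn). The slope is a
-- field, hence the same for all n.
record Affine (p : ℤ) (g f : ℤ → ℤ) (c : ℤ) : Set where
  constructor affine
  field
    slope : ℤ
    expansion : ∀ n → f n ≈ g n * (c + p * n * slope) [mod p * p ]

one : ℤ → ℤ
one _ = + 1

affine-const : ∀ {p} c → Affine p one (λ _ → c) c
affine-const {p} c = affine (+ 0) λ n → mod (+ 0) (lemma p c n)
  where
  lemma : ∀ p c n → c ≡ + 1 * (c + p * n * + 0) + + 0 * (p * p)
  lemma = solve-∀

affine-shift : ∀ {p} c → Affine p one (λ n → c + p * n) c
affine-shift {p} c = affine (+ 1) λ n → mod (+ 0) (lemma p c n)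
  where
  lemma : ∀ p c n → c + p * n ≡ + 1 * (c + p * n * + 1) + + 0 * (p * p)
  lemma = solve-∀

affine-+ : ∀ {p g f h c d} → Affine p g f c → Affine p g h d → Affine p g (λ n → f n + h n) (c + d)
affine-+ {p} {g} {c = c} {d} (affine s f≈) (affine t h≈) = affine (s + t) λ n →
  ≈-trans (+-cong-≈ (f≈ n) (h≈ n)) (mod (+ 0) (lemma p c d s t n (g n)))
  where
  lemma : ∀ p c d s t n g → g * (c + p * n * s) + g * (d + p * n * t) ≡ g * (c + d + p * n * (s + t)) + + 0 * (p * p)
  lemma = solve-∀

-- One factor has weight `one`, so the product keeps the weight `g`. The term quadratic in pn is
-- absorbed by the modulus.
affine-* : ∀ {p g f h c d} → Affine p one f c → Affine p g h d → Affine p g (λ n → f n * h n) (c * d)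
affine-* {p} {g} {c = c} {d} (affine s f≈) (affine t h≈) = affine (c * t + s * d) λ n →
  ≈-trans (*-cong-≈ (f≈ n) (h≈ n)) (mod (g n * (n * n * s * t)) (lemma p c d s t n (g n)))
  where
  lemma : ∀ p c d s t n g → + 1 * (c + p * n * s) * (g * (d + p * n * t)) ≡
          g * (c * d + p * n * (c * t + s * d)) + g * (n * n * s * t) * (p * p)
  lemma = solve-∀

affine-scale : ∀ {p g f d} c → Affine p g f d → Affine p g (λ n → c * f n) (c * d)
affine-scale c = affine-* (affine-const c)

affine-cube : ∀ {p f c} → Affine p one f c → Affine p one (λ n → cube (f n)) (cube c)
affine-cube f = affine-* (affine-* f f) f

affine-middle : ∀ {p f c} → Affine p one f c → Affine p one (λ n → middle (f n)) (middle c)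
affine-middle f = affine-+ (affine-+ (affine-+ (affine-scale (+ 34) (affine-cube f))
  (affine-scale (+ 51) (affine-* f f))) (affine-scale (+ 27) f)) (affine-const (+ 5))

affine-cong : ∀ {p g f h c d} → (∀ n → f n ≈ h n [mod p * p ]) → c ≡ d → Affine p g f c → Affine p g h d
affine-cong f≈h refl (affine s f≈) = affine s λ n → ≈-trans (≈-sym (f≈h n)) (f≈ n)

-- Expanding A(d + pn) through the recurrence.

-- A denominator s prime to p replaces division by powers of d! modulo p².
Gessel : ℕ → (ℤ → ℤ) → ℤ → Set
Gessel p f c = ∃[ s ] (¬ + p ∣ₛ s × Affine (+ p) (λ n → A (+ p * n)) (λ n → s * f n) (s * c))

-- The recurrence at z = d + pn, solved for (z + 1)³ A(z + 1), with the two expansions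
-- cross-multiplied to the common denominator st. Keeping z³ attached to A(z - 1) in the second
-- premise lets the case d = 0 in without any expansion of A(pn - 1).
gessel-step : ∀ {p} → Prime p → ∀ d → suc d < p →
  Gessel p (λ n → A (+ d + + p * n)) (A (+ d)) →
  Gessel p (λ n → cube (+ d + + p * n) * A (+ d + + p * n - + 1)) (cube (+ d) * A (+ d - + 1)) →
  Gessel p (λ n → A (+ suc d + + p * n)) (A (+ suc d))
gessel-step {p} p-prime d d<p (s , p∤s , A-affine) (t , p∤t , A⁻-affine) =
  cube u * cube u * (s * t) , euclid-∤ p-prime (euclid-∤ p-prime p∤u³ p∤u³) (euclid-∤ p-prime p∤s p∤t) ,
  affine-cong function value
    (affine-* (affine-cube opposite)
      (affine-+ (affine-scale t (affine-* (affine-middle (affine-shift (+ d))) A-affine))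
                (affine-scale (- s) A⁻-affine)))
  where
  u = + suc d

  p∤u : ¬ + p ∣ₛ u
  p∤u = ℕ.>⇒∤ d<p ∘ ∣⇒∣ᵤ
  p∤u³ : ¬ + p ∣ₛ cube u
  p∤u³ = euclid-∤ p-prime (euclid-∤ p-prime p∤u p∤u) p∤u

  opposite : Affine (+ p) one (λ n → u - + p * n) u
  opposite = affine (- + 1) λ n → mod (+ 0) (lemma u (+ p) n)
    where
    lemma : ∀ u p n → u - p * n ≡ + 1 * (u + p * n * - + 1) + + 0 * (p * p)
    lemma = solve-∀

  solved : ∀ z w → z + + 1 ≡ w →
           t * (middle z * (s * A z)) + - s * (t * (cube z * A (z - + 1))) ≡ s * t * (cube w * A w)
  solved z _ refl = begin
    t * (middle z * (s * A z)) + - s * (t * (cube z * A (z - + 1)))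
      ≡⟨ lemma₁ s t (middle z) (A z) (cube z * A (z - + 1)) ⟩
    s * t * (middle z * A z - cube z * A (z - + 1))
      ≡⟨ cong (λ x → s * t * (x - cube z * A (z - + 1))) (A-recurrence z) ⟨
    s * t * (cube (z + + 1) * A (z + + 1) + cube z * A (z - + 1) - cube z * A (z - + 1))
      ≡⟨ lemma₂ (s * t) (cube (z + + 1) * A (z + + 1)) (cube z * A (z - + 1)) ⟩
    s * t * (cube (z + + 1) * A (z + + 1)) ∎
    where
    open ≡-Reasoning
    lemma₁ : ∀ s t m a b → t * (m * (s * a)) + - s * (t * b) ≡ s * t * (m * a - b)
    lemma₁ = solve-∀
    lemma₂ : ∀ r x y → r * (x + y - y) ≡ r * x
    lemma₂ = solve-∀

  successor : ∀ d x → d + x + + 1 ≡ + 1 + d + x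
  successor = solve-∀

  -- (u - pn)³ inverts (u + pn)³ up to the constant u⁶ modulo p².
  function : ∀ n →
    cube (u - + p * n) * (t * (middle (+ d + + p * n) * (s * A (+ d + + p * n)))
      + - s * (t * (cube (+ d + + p * n) * A (+ d + + p * n - + 1)))) ≈
    cube u * cube u * (s * t) * A (u + + p * n) [mod + p * + p ]
  function n = begin
    cube (u - x) * (t * (middle (+ d + x) * (s * A (+ d + x))) + - s * (t * (cube (+ d + x) * A (+ d + x - + 1))))
      ≡⟨ cong (cube (u - x) *_) (solved (+ d + x) (u + x) (successor (+ d) x)) ⟩
    cube (u - x) * (s * t * (cube (u + x) * A (u + x)))
      ≡⟨ lemma₁ (u - x) (u + x) (s * t) (A (u + x)) ⟩
    cube ((u - x) * (u + x)) * (s * t * A (u + x))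
      ≈⟨ *-congʳ-≈ (s * t * A (u + x)) (*-cong-≈ (*-cong-≈ norm norm) norm) ⟩
    cube (u * u) * (s * t * A (u + x))
      ≡⟨ lemma₃ u (s * t) (A (u + x)) ⟩
    cube u * cube u * (s * t) * A (u + x) ∎
    where
    open SetoidReasoning (≈-setoid (+ p * + p))
    x = + p * n
    lemma₁ : ∀ v w r a → v * v * v * (r * (w * w * w * a)) ≡ v * w * (v * w) * (v * w) * (r * a)
    lemma₁ = solve-∀
    lemma₂ : ∀ u p n → (u - p * n) * (u + p * n) ≡ u * u + - (n * n) * (p * p)
    lemma₂ = solve-∀
    norm : (u - x) * (u + x) ≈ u * u [mod + p * + p ]
    norm = mod (- (n * n)) (lemma₂ u (+ p) n)
    lemma₃ : ∀ u r a → u * u * (u * u) * (u * u) * (r * a) ≡ u * u * u * (u * u * u) * r * a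
    lemma₃ = solve-∀

  -- Constant terms have to agree exactly, not only modulo p²; this is the same elimination at pn =
  -- 0.
  value : cube u * (t * (middle (+ d) * (s * A (+ d))) + - s * (t * (cube (+ d) * A (+ d - + 1)))) ≡
          cube u * cube u * (s * t) * A u
  value = trans (cong (cube u *_) (solved (+ d) u (ℤ.+-comm (+ d) (+ 1)))) (lemma (cube u) (s * t) (A u))
    where
    lemma : ∀ c r a → c * (r * (c * a)) ≡ c * c * r * a
    lemma = solve-∀

gessel-cube : ∀ {p} d → Gessel p (λ n → A (+ d + + p * n)) (A (+ d)) →
  Gessel p (λ n → cube (+ suc d + + p * n) * A (+ suc d + + p * n - + 1)) (cube (+ suc d) * A (+ suc d - + 1))
gessel-cube {p} d (s , p∤s , A-affine) = s , p∤s ,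
  affine-cong (λ n → ≈-reflexive (commute (cube (+ suc d + + p * n)) (predecessor (+ d) (+ p * n))))
    (commute (cube (+ suc d)) {+ d} refl)
    (affine-* (affine-cube (affine-shift (+ suc d))) A-affine)
  where
  predecessor : ∀ d x → d + x ≡ + 1 + d + x - + 1
  predecessor = solve-∀
  commute : ∀ c {x y} → x ≡ y → c * (s * A x) ≡ s * (c * A y)
  commute c {x} refl = lemma c s (A x)
    where
    lemma : ∀ c s a → c * (s * a) ≡ s * (c * a)
    lemma = solve-∀

gessel-0 : ∀ {p} → Prime p → Gessel p (λ n → A (+ 0 + + p * n)) (A (+ 0))
gessel-0 {p} p-prime = + 1 , prime∤1 p-prime , affine (+ 0) λ n →
  subst (λ x → + 1 * A x ≈ A (+ p * n) * (+ 1 + + p * n * + 0) [mod + p * + p ])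
    (sym (ℤ.+-identityˡ (+ p * n))) (mod (+ 0) (lemma (A (+ p * n)) (+ p) n))
  where
  lemma : ∀ a p n → + 1 * a ≡ a * (+ 1 + p * n * + 0) + + 0 * (p * p)
  lemma = solve-∀

-- (pn)³ is a multiple of p², so constant term and slope are both zero whatever A(pn - 1) is.
gessel-cube-0 : ∀ {p} → Prime p →
  Gessel p (λ n → cube (+ 0 + + p * n) * A (+ 0 + + p * n - + 1)) (cube (+ 0) * A (+ 0 - + 1))
gessel-cube-0 {p} p-prime = + 1 , prime∤1 p-prime , affine (+ 0) λ n →
  mod (+ p * n * (n * n) * A (+ 0 + + p * n - + 1)) (lemma (A (+ 0 + + p * n - + 1)) (A (+ p * n)) (+ p) n)
  where
  lemma : ∀ a b p n → let x = + 0 + p * n in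
    + 1 * (x * x * x * a) ≡ b * (+ 0 + p * n * + 0) + p * n * (n * n) * a * (p * p)
  lemma = solve-∀

gessel : ∀ {p} → Prime p → ∀ d → d < p → Gessel p (λ n → A (+ d + + p * n)) (A (+ d))
gessel p-prime zero          _   = gessel-0 p-prime
gessel p-prime (suc zero)    1<p = gessel-step p-prime 0 1<p (gessel-0 p-prime) (gessel-cube-0 p-prime)
gessel p-prime (suc (suc d)) d<p = gessel-step p-prime (suc d) d<p
  (gessel p-prime (suc d) (ℕ.<-trans (ℕ.n<1+n _) d<p))
  (gessel-cube d (gessel p-prime d (ℕ.<-trans (ℕ.n<1+n _) (ℕ.<-trans (ℕ.n<1+n _) d<p))))

-- The value at n = -1 and the criterion.

A-≈ : ∀ {p} → Prime p → ∀ n → A (+ p * n) ≈ A n [mod + p * + p ]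
A-≈ {zero}  p-prime = contradiction p-prime ¬prime[0]
A-≈ {suc p} p-prime = A-≈-suc p p-prime

-- d - p is the reflection of p - 1 - d.
A-complement : ∀ {p d} → d < p → A (+ d + + p * - + 1) ≡ A (+ (p ∸ 1 ∸ d))
A-complement {suc p} {d} d<p = trans (cong A (begin
  + d + + suc p * - + 1        ≡⟨ lemma (+ d) (+ p) ⟩
  - + 1 - (+ p - + d)          ≡⟨ cong (λ x → - + 1 - x) (trans (ℤ.m-n≡m⊖n p d) (ℤ.⊖-≥ (ℕ.s≤s⁻¹ d<p))) ⟩
  reflect (+ (p ∸ d))          ∎)) (A-reflect (+ (p ∸ d)))
  where
  open ≡-Reasoning
  lemma : ∀ d p → d + (+ 1 + p) * - + 1 ≡ - + 1 - (p - d)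
  lemma = solve-∀

complement⇒lucas : ∀ {p} → Prime p → ∀ {d} → d < p → A (+ d) ≈ A (+ (p ∸ 1 ∸ d)) [mod + p * + p ] →
  ∀ n → A (+ d + + p * n) ≈ A (+ d) * A n [mod + p * + p ]
complement⇒lucas {p} p-prime {d} d<p A≈ n with gessel p-prime d d<p
... | s , p∤s , affine e expansion = ≈-cancel p-prime p∤s (begin
  s * A (+ d + + p * n)                                  ≈⟨ expansion n ⟩
  A (+ p * n) * (s * A (+ d) + + p * n * e)              ≡⟨ lemma₃ (A (+ p * n)) (s * A (+ d)) (+ p) n e ⟩
  A (+ p * n) * (s * A (+ d) + n * (+ p * e))            ≈⟨ *-cong-≈ (A-≈ p-prime n)
                                                             (+-cong-≈ (≈-refl {x = s * A (+ d)}) (*-congˡ-≈ n pe≈0)) ⟩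
  A n * (s * A (+ d) + n * + 0)                          ≡⟨ lemma₄ (A n) s (A (+ d)) n ⟩
  s * (A (+ d) * A n)                                    ∎)
  where
  open SetoidReasoning (≈-setoid (+ p * + p))
  lemma₁ : ∀ x p e → p * e ≡ x + - + 1 * (+ 1 * (x + p * - + 1 * e))
  lemma₁ = solve-∀
  lemma₂ : ∀ x → x + - + 1 * x ≡ + 0
  lemma₂ = solve-∀
  lemma₃ : ∀ a x p n e → a * (x + p * n * e) ≡ a * (x + n * (p * e))
  lemma₃ = solve-∀
  lemma₄ : ∀ a s b n → a * (s * b + n * + 0) ≡ s * (b * a)
  lemma₄ = solve-∀
  -- At n = -1 the weight is A(-p) ≡ A(-1) = 1, so the expansion reads s A(d - p) ≡ s A(d) - pe, and
  -- the left side is s A(p - 1 - d) ≡ s A(d).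
  pe≈0 : + p * e ≈ + 0 [mod + p * + p ]
  pe≈0 = begin
    + p * e
      ≡⟨ lemma₁ (s * A (+ d)) (+ p) e ⟩
    s * A (+ d) + - + 1 * (+ 1 * (s * A (+ d) + + p * - + 1 * e))
      ≈⟨ +-cong-≈ (≈-refl {x = s * A (+ d)}) (*-congˡ-≈ (- + 1)
           (*-congʳ-≈ (s * A (+ d) + + p * - + 1 * e) (A-≈ p-prime (- + 1)))) ⟨
    s * A (+ d) + - + 1 * (A (+ p * - + 1) * (s * A (+ d) + + p * - + 1 * e))
      ≈⟨ +-cong-≈ (≈-refl {x = s * A (+ d)}) (*-congˡ-≈ (- + 1) (expansion (- + 1))) ⟨
    s * A (+ d) + - + 1 * (s * A (+ d + + p * - + 1))
      ≡⟨ cong (λ x → s * A (+ d) + - + 1 * (s * x)) (A-complement d<p) ⟩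
    s * A (+ d) + - + 1 * (s * A (+ (p ∸ 1 ∸ d)))
      ≈⟨ +-cong-≈ (≈-refl {x = s * A (+ d)}) (*-congˡ-≈ (- + 1) (*-congˡ-≈ s A≈)) ⟨
    s * A (+ d) + - + 1 * (s * A (+ d))
      ≡⟨ lemma₂ (s * A (+ d)) ⟩
    + 0 ∎

theorem2 : (p : ℕ) → Prime p → (d : ℕ) → d < p →
    ((∀ (n : ℤ) → (+ (p ℕ.* p)) ∣ (A (+ d + + p * n) - A (+ d) * A n))
    ⇔ ((+ (p ℕ.* p)) ∣ (A (+ d) - A (+ (p ∸ 1 ∸ d)))))
theorem2 p p-prime d d<p = mk⇔
  -- The single instance n = -1 suffices; `A (- + 1)` computes to `+ 1`.
  (λ lucas → from≈ (≈-sym (subst₂ (λ x y → x ≈ y [mod + p * + p ])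
    (A-complement d<p) (ℤ.*-identityʳ (A (+ d))) (to≈ (A (+ d + + p * - + 1)) (A (+ d) * + 1) (lucas (- + 1))))))
  (λ A≈ n → from≈ (complement⇒lucas p-prime d<p (to≈ (A (+ d)) (A (+ (p ∸ 1 ∸ d))) A≈) n))
  where
  to≈ : ∀ x y → + (p ℕ.* p) ∣ x - y → x ≈ y [mod + p * + p ]
  to≈ x y p²∣ = subst (x ≈ y [mod_]) (ℤ.pos-* p p) (∣⇒≈ (∣ᵤ⇒∣ p²∣))
  from≈ : ∀ {x y} → x ≈ y [mod + p * + p ] → + (p ℕ.* p) ∣ x - y
  from≈ {x} {y} x≈y = ∣⇒∣ᵤ (≈⇒∣ (subst (x ≈ y [mod_]) (sym (ℤ.pos-* p p)) x≈y))
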